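{- Let $n$ be a positive integer and let $G$ be a simple graph. Then $G$ is isomorphic to the triangular book graph $B_n$ if and only if $$[x]\,da(G;x,y) = 2y + n\,y^{n}.$$
   Context: All graphs are finite, simple and have at least one vertex. For a graph $G$, $S\subseteq V(G)$ and $u\in V(G)$, let $\bar S=V(G)\setminus S$, let $\delta_S(u)=|\{v\in S:\{u,v\}\in E(G)\}|$, and let $G[S]$ be the subgraph induced by $S$. The defensive alliance polynomial of $G$ is $$da(G;x,y)=\sum_{S} x^{|S|}\,y^{f_y(S)},\qquad f_y(S)=\min_{u\in S}\bigl(\delta_S(u)-\delta_{\bar S}(u)+|V(G)|\bigr),$$ where the sum runs over all non-empty $S\subseteq V(G)$ such that $G[S]$ is connected (single-vertex graphs are connected). $[x^k]\,da(G;x,y)$ denotes the coefficient of $x^k$ in $da(G;x,y)$, which is a polynomial in $y$. The triangular book graph $B_n$ is the graph join $nK_1+K_2$, i.e. two adjacent vertices together with $n$ pairwise non-adjacent vertices, each adjacent to both of them (so it has $n+2$ vertices). -}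

module Defs where

open import Algebra.Bundles.Raw using (RawMonoid)
open import Data.Empty using (⊥)
open import Data.Fin.Base using (Fin; zero; suc)
open import Data.Fin.Properties using (_≟_; any?; all?)
open import Data.Fin.Subset using (Subset; inside; outside; _∈_; _∩_; ∁; ∣_∣; Nonempty)
open import Data.Fin.Subset.Properties using (_∈?_; nonempty?)
open import Data.List.Base using (List; []; _∷_; [_]; _++_; map; foldr; filter; replicate; allFin)
open import Data.List.Extrema.Nat using (min)
import Data.Nat.Base as ℕ
open import Data.Nat.Base using (ℕ; zero; suc; _+_; _∸_)
open import Data.Product.Base using (∃; _×_; _,_; proj₁)
open import Data.Sum.Base using (_⊎_; inj₁; inj₂)
open import Data.Unit.Base using (⊤; tt)
import Data.Vec.Base as Vec
open import Data.Vec.Properties.WithK using ([]=-irrelevant)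
open import Function.Base using (_∘_; id)
open import Function.Bundles using (_↔_; _⇔_; Inverse)
open import Level using (0ℓ)
open import Relation.Binary.Core using (Rel)
open import Relation.Binary.Construct.Closure.ReflexiveTransitive using (Star; ε; _◅_; _◅◅_)
open import Relation.Binary.Definitions using (Decidable; Symmetric)
open import Relation.Binary.PropositionalEquality.Core using (_≡_; _≢_; refl; sym)
open import Relation.Nullary.Decidable using (Dec; yes; no; does; map′; ¬?; _×-dec_; _⊎-dec_; _→-dec_)
open import Relation.Nullary.Negation using (¬_)

-- Polynomials in one variable, as lists of coefficients in order of
-- increasing degree.  Trailing zeros are allowed, so equality is _≈ᴾ_.
-- Only the additive structure of the coefficients is used.

module Polynomial {c ℓ} (M : RawMonoid c ℓ) where
  open RawMonoid M renaming (ε to 0#)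

  Poly : Set c
  Poly = List Carrier

  coeff : ℕ → Poly → Carrier
  coeff _       []      = 0#
  coeff zero    (a ∷ p) = a
  coeff (suc k) (a ∷ p) = coeff k p

  infix 4 _≈ᴾ_
  _≈ᴾ_ : Rel Poly ℓ
  p ≈ᴾ q = ∀ k → coeff k p ≈ coeff k q

  infixl 6 _+ᴾ_
  _+ᴾ_ : Poly → Poly → Poly
  []      +ᴾ q       = q
  (a ∷ p) +ᴾ []      = a ∷ p
  (a ∷ p) +ᴾ (b ∷ q) = (a ∙ b) ∷ (p +ᴾ q)

  monomial : Carrier → ℕ → Poly
  monomial a k = replicate k 0# ++ [ a ]

  rawMonoid : RawMonoid c ℓ
  rawMonoid = record { Carrier = Poly ; _≈_ = _≈ᴾ_ ; _∙_ = _+ᴾ_ ; ε = [] }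

module Y = Polynomial ℕ.+-0-rawMonoid
module X = Polynomial Y.rawMonoid

ℕ[y] ℕ[x,y] : Set
ℕ[y]   = Y.Poly
ℕ[x,y] = X.Poly

open Y public using () renaming (_≈ᴾ_ to _≈_; _+ᴾ_ to _⊕_)

infix 7 _·y^_
_·y^_ : ℕ → ℕ → ℕ[y]
a ·y^ k = Y.monomial a k

x^_y^_ : ℕ → ℕ → ℕ[x,y]
x^ i y^ j = X.monomial (1 ·y^ j) i

[x^_]_ : ℕ → ℕ[x,y] → ℕ[y]
[x^ k ] p = X.coeff k p

record Graph (V : Set) : Set₁ where
  infix 4 _~_ _~?_
  field
    _~_    : Rel V 0ℓ
    ~-sym  : Symmetric _~_
    ~-irr  : ∀ {u} → ¬ (u ~ u)
    _~?_   : Decidable _~_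

infix 4 _≅_
record _≅_ {V W : Set} (G : Graph V) (H : Graph W) : Set where
  private
    module G = Graph G
    module H = Graph H
  field
    bijection : V ↔ W
  open Inverse bijection using (to)
  field
    adjacency : ∀ u v → (u G.~ v) ⇔ (to u H.~ to v)

complete : ∀ n → Graph (Fin n)
complete n = record
  { _~_   = _≢_
  ; ~-sym = λ u≢v → u≢v ∘ sym
  ; ~-irr = λ u≢u → u≢u refl
  ; _~?_  = λ u v → ¬? (u ≟ v)
  }

_K₁ : ∀ n → Graph (Fin n)
n K₁ = record
  { _~_   = λ _ _ → ⊥
  ; ~-sym = id
  ; ~-irr = id
  ; _~?_  = λ _ _ → no id
  }

module _ {V W : Set} (G : Graph V) (H : Graph W) where
  private
    module G = Graph G
    module H = Graph H

    _~_ : Rel (V ⊎ W) 0ℓ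
    inj₁ u ~ inj₁ v = u G.~ v
    inj₁ _ ~ inj₂ _ = ⊤
    inj₂ _ ~ inj₁ _ = ⊤
    inj₂ u ~ inj₂ v = u H.~ v

    ~-sym : ∀ u v → u ~ v → v ~ u
    ~-sym (inj₁ _) (inj₁ _) = G.~-sym
    ~-sym (inj₁ _) (inj₂ _) = id
    ~-sym (inj₂ _) (inj₁ _) = id
    ~-sym (inj₂ _) (inj₂ _) = H.~-sym

    ~-irr : ∀ u → ¬ (u ~ u)
    ~-irr (inj₁ _) = G.~-irr
    ~-irr (inj₂ _) = H.~-irr

    _~?_ : Decidable _~_
    inj₁ u ~? inj₁ v = u G.~? v
    inj₁ _ ~? inj₂ _ = yes tt
    inj₂ _ ~? inj₁ _ = yes tt
    inj₂ u ~? inj₂ v = u H.~? v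

  join : Graph (V ⊎ W)
  join = record
    { _~_   = _~_
    ; ~-sym = λ {u} {v} → ~-sym u v
    ; ~-irr = λ {u} → ~-irr u
    ; _~?_  = _~?_
    }

B : ∀ n → Graph (Fin n ⊎ Fin 2)
B n = join (n K₁) (complete 2)

Connected : ∀ {V} → Graph V → Set
Connected G = ∀ u v → Star (Graph._~_ G) u v

infix 8 _⟨_⟩
_⟨_⟩ : ∀ {n} → Graph (Fin n) → (S : Subset n) → Graph (∃ (_∈ S))
G ⟨ S ⟩ = record
  { _~_   = λ u v → proj₁ u G.~ proj₁ v
  ; ~-sym = G.~-sym
  ; ~-irr = G.~-irr
  ; _~?_  = λ u v → proj₁ u G.~? proj₁ v
  }
  where module G = Graph G

-- Reachability on a finite type is decidable: vertex zero is eliminated by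
-- turning every walk i, zero, j into a single step.

module _ {n} {R : Rel (Fin (suc n)) 0ℓ} where
  private
    Bypass : Rel (Fin n) 0ℓ
    Bypass i j = R (suc i) (suc j) ⊎ (R (suc i) zero × R zero (suc j))

  bypass? : Decidable R → Decidable Bypass
  bypass? R? i j = R? (suc i) (suc j) ⊎-dec (R? (suc i) zero ×-dec R? zero (suc j))

  expand : ∀ {i j} → Star Bypass i j → Star R (suc i) (suc j)
  expand ε                    = ε
  expand (inj₁ r       ◅ rs) = r ◅ expand rs
  expand (inj₂ (r , s) ◅ rs) = r ◅ s ◅ expand rs

  contract  : ∀ {i j} → Star R (suc i) (suc j) → Star Bypass i j
  contract₀ : ∀ {j} → Star R zero (suc j) → ∃ λ k → R zero (suc k) × Star Bypass k j

  contract ε = ε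
  contract (_◅_ {j = suc _} r rs) = inj₁ r ◅ contract rs
  contract (_◅_ {j = zero}  r rs) with contract₀ rs
  ... | _ , s , ss = inj₂ (r , s) ◅ ss

  contract₀ (_◅_ {j = suc k} r rs) = k , r , contract rs
  contract₀ (_◅_ {j = zero}  r rs) = contract₀ rs

  contract₁ : ∀ {i} → Star R (suc i) zero → ∃ λ k → Star Bypass i k × R (suc k) zero
  contract₁ (_◅_ {j = zero}  r rs) = _ , ε , r
  contract₁ (_◅_ {j = suc _} r rs) with contract₁ rs
  ... | k , ss , s = k , inj₁ r ◅ ss , s

star? : ∀ {n} {R : Rel (Fin n) 0ℓ} → Decidable R → Decidable (Star R)
star? R? zero    zero    = yes ε
star? R? zero    (suc j) = map′ (λ (_ , r , rs) → r ◅ expand rs) contract₀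
  (any? λ k → R? zero (suc k) ×-dec star? (bypass? R?) k j)
star? R? (suc i) zero    = map′ (λ (_ , rs , r) → expand rs ◅◅ r ◅ ε) contract₁
  (any? λ k → star? (bypass? R?) i k ×-dec R? (suc k) zero)
star? R? (suc i) (suc j) = map′ expand contract (star? (bypass? R?) i j)

module _ {n} (G : Graph (Fin n)) where
  open Graph G

  module _ (S : Subset n) where
    private
      Within : Rel (Fin n) 0ℓ
      Within u v = u ∈ S × v ∈ S × u ~ v

      within? : Decidable Within
      within? u v = u ∈? S ×-dec v ∈? S ×-dec u ~? v

      toWithin : ∀ {u v} → Star (Graph._~_ (G ⟨ S ⟩)) u v → Star Within (proj₁ u) (proj₁ v)
      toWithin ε = ε
      toWithin (_◅_ {i = _ , u∈S} {j = _ , v∈S} r rs) = (u∈S , v∈S , r) ◅ toWithin rs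

      fromWithin : ∀ {u v} (u∈S : u ∈ S) (v∈S : v ∈ S) →
                   Star Within u v → Star (Graph._~_ (G ⟨ S ⟩)) (u , u∈S) (v , v∈S)
      fromWithin u∈S v∈S ε with refl ← []=-irrelevant u∈S v∈S = ε
      fromWithin u∈S v∈S (_◅_ (_ , w∈S , r) rs) = r ◅ fromWithin w∈S v∈S rs

    connected? : Dec (Connected (G ⟨ S ⟩))
    connected? = map′
      (λ c (u , u∈S) (v , v∈S) → fromWithin u∈S v∈S (c u v u∈S v∈S))
      (λ c u v u∈S v∈S → toWithin (c (u , u∈S) (v , v∈S)))
      (all? λ u → all? λ v → u ∈? S →-dec (v ∈? S →-dec star? within? u v))

  neighbours : Fin n → Subset n
  neighbours u = Vec.tabulate λ v → does (u ~? v)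

  δ : Subset n → Fin n → ℕ
  δ S u = ∣ S ∩ neighbours u ∣

elements : ∀ {n} → Subset n → List (Fin n)
elements {n} S = filter (_∈? S) (allFin n)

subsets : ∀ n → List (Subset n)
subsets zero    = [ Vec.[] ]
subsets (suc n) = map (outside Vec.∷_) (subsets n) ++ map (inside Vec.∷_) (subsets n)

-- The value on the empty list is never used below.
minimum : List ℕ → ℕ
minimum []       = 0
minimum (k ∷ ks) = min k ks

-- The subtraction never truncates, as δ G (∁ S) u ≤ n.
fy : ∀ {n} → Graph (Fin n) → Subset n → ℕ
fy {n} G S = minimum (map (λ u → (δ G S u + n) ∸ δ G (∁ S) u) (elements S))

da : ∀ {n} → Graph (Fin n) → ℕ[x,y]
da {n} G = foldr X._+ᴾ_ [] (map (λ S → x^ ∣ S ∣ y^ fy G S) (filter summand? (subsets n)))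
  where
  summand? : ∀ S → Dec (Nonempty S × Connected (G ⟨ S ⟩))
  summand? S = nonempty? S ×-dec connected? G S

{-# OPTIONS --safe #-}

-- A vertex i contributes x y^(m − deg i) to da(G; x, y), and m − deg i is the
-- number of vertices not adjacent to i, counting i itself: its codegree.  So
-- the coefficient of x records how many vertices have each codegree.  In B_n
-- the two centres have codegree 1 and the n other vertices have codegree n.
-- Conversely, split off two vertices of codegree 1 and cancel them: every one
-- of the remaining vertices has codegree n, so there are n of them.  The two
-- are adjacent to everything, hence the n non-neighbours of a remaining vertex
-- are exactly the remaining vertices.  This treats n = 1, where all three
-- vertices have codegree 1, like every other n.

module Submission where

open import Defs
open import Data.Bool.Base using (Bool; true; false; not; if_then_else_)
open import Data.Fin.Base using (Fin; zero; suc; splitAt; opposite)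
open import Data.Fin.Patterns using (0F; 1F)
import Data.Fin.Properties as Fin
open import Data.Fin.Subset using (Subset; inside; outside; ⁅_⁆; ∁; _∩_; ∣_∣; _∈_) renaming (⊥ to ∅)
open import Data.Fin.Subset.Properties
  using ( _∈?_; x∈⁅x⁆; x∈⁅y⁆⇒x≡y; ∣⁅x⁆∣≡1; ∣∁p∣≡n∸∣p∣; ∣⊥∣≡0; ∣p∣≡n⇒p≡⊤
        ; Empty-unique; ⊆-antisym; p∩q⊆q; x∈p∩q⁺; x∈p∩q⁻; x∉p⇒x∈∁p)
open import Data.List.Base using ([]; _∷_; _++_; map; foldr; filter; allFin)
open import Data.List.Extrema.Nat using (min≤⊤; v≤min⁺)
open import Data.List.Membership.Propositional using () renaming (_∈_ to _∈ₗ_)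
open import Data.List.Membership.Propositional.Properties using (∈-filter⁺; ∈-map⁺; ∈-allFin)
open import Data.List.Properties using (map-++; map-∘)
open import Data.List.Relation.Unary.All as All using (All; _∷_)
import Data.List.Relation.Unary.All.Properties as All
open import Data.Nat.Base using (ℕ; zero; suc; _+_; _*_; _∸_; _≤_; z≤n; s≤s⁻¹; NonZero)
import Data.Nat.ListAction as List
open import Data.Nat.ListAction.Properties using (sum-++)
open import Data.Nat.Properties as ℕ using (+-0-commutativeMonoid; _≟_)
open import Data.Product.Base using (∃; ∃₂; _,_)
open import Data.Sum.Base using (_⊎_; inj₁; inj₂; map₁; swap)
open import Data.Sum.Properties using (swap-involutive)
open import Data.Unit.Base using (tt)
open import Data.Vec.Base as Vec using (lookup; tabulate)
open import Data.Vec.Properties using ([]=⇒lookup; lookup∘tabulate; tabulate-∘; lookup-replicate)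
open import Data.Vec.Properties.WithK using ([]=-irrelevant)
open import Function.Base using (_∘_)
open import Function.Bundles using (_↔_; _⇔_; mk↔ₛ′; mk⇔; Inverse)
open import Function.Construct.Composition using (_↔-∘_)
open import Function.Construct.Symmetry using (↔-sym)
open import Relation.Binary.Construct.Closure.ReflexiveTransitive using (ε)
open import Relation.Binary.PropositionalEquality
open import Relation.Nullary.Decidable using (Dec; yes; no; does; ¬?; does-⇔; dec-true)
open import Relation.Nullary.Negation using (¬_; contradiction)
open import Relation.Unary using (Decidable)

open import Algebra.Properties.CommutativeMonoid.Sum +-0-commutativeMonoid
  using (sum; sum-cong-≗; sum-permute)

open ≡-Reasoning

-- Indicators and finite sums.

𝟙 : Bool → ℕ
𝟙 b = if b then 1 else 0

⟦_⟧ : {P : Set} → Dec P → ℕ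
⟦ p? ⟧ = 𝟙 (does p?)

module _ {P : Set} where

  does≡true⇒ : (p? : Dec P) → does p? ≡ true → P
  does≡true⇒ (yes p) _ = p

  ⟦⟧-true : (p? : Dec P) → P → ⟦ p? ⟧ ≡ 1
  ⟦⟧-true (yes _) _ = refl
  ⟦⟧-true (no ¬p) p = contradiction p ¬p

  ⟦¬⟧≡0⇒ : (p? : Dec P) → ⟦ ¬? p? ⟧ ≡ 0 → P
  ⟦¬⟧≡0⇒ (yes p) _ = p

sum-const : ∀ {n c} {f : Fin n → ℕ} → (∀ i → f i ≡ c) → sum f ≡ n * c
sum-const {zero}  f≡c = refl
sum-const {suc n} f≡c = cong₂ _+_ (f≡c zero) (sum-const (f≡c ∘ suc))

sum≡0⇒≡0 : ∀ {n} (f : Fin n → ℕ) → sum f ≡ 0 → ∀ i → f i ≡ 0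
sum≡0⇒≡0 f eq zero    = ℕ.m+n≡0⇒m≡0 (f zero) eq
sum≡0⇒≡0 f eq (suc i) = sum≡0⇒≡0 (f ∘ suc) (ℕ.m+n≡0⇒n≡0 (f zero) eq) i

-- Composing `e` with the standard bijection between `Fin (k + l)` and `Fin k ⊎ Fin l` permutes the
-- sum into one over `Fin (k + l)`, which is then cut after its first `k` terms.
sum-⊎ : ∀ {m k l} (e : Fin m ↔ (Fin k ⊎ Fin l)) (f : Fin m → ℕ) → let open Inverse e in
        sum f ≡ sum (f ∘ from ∘ inj₁) + sum (f ∘ from ∘ inj₂)
sum-⊎ {m} {k} {l} e f = trans (sum-permute f (↔-sym e ↔-∘ Fin.+↔⊎)) (split k (f ∘ Inverse.from e))
  where
  split : ∀ k (g : Fin k ⊎ Fin l → ℕ) → sum (g ∘ splitAt k) ≡ sum (g ∘ inj₁) + sum (g ∘ inj₂)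
  split zero    g = refl
  split (suc k) g = trans (cong (g (inj₁ zero) +_) (split k (g ∘ map₁ suc)))
                          (sym (ℕ.+-assoc (g (inj₁ zero)) _ _))

∣tabulate∣ : ∀ {n} (b : Fin n → Bool) → ∣ tabulate b ∣ ≡ sum (𝟙 ∘ b)
∣tabulate∣ {zero}  b = refl
∣tabulate∣ {suc n} b with b zero
... | true  = cong suc (∣tabulate∣ (b ∘ suc))
... | false = ∣tabulate∣ (b ∘ suc)

-- An indicator sum is the size of a subset of `Fin n`, and only the full subset has size `n`.
sum≡n⇒all : ∀ {n} {P : Fin n → Set} (P? : Decidable P) → sum (λ i → ⟦ P? i ⟧) ≡ n → ∀ i → P i
sum≡n⇒all P? eq i = does≡true⇒ (P? i) (begin
  does (P? i)                        ≡⟨ lookup∘tabulate (does ∘ P?) i ⟨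
  lookup (tabulate (does ∘ P?)) i    ≡⟨ cong (λ p → lookup p i) (∣p∣≡n⇒p≡⊤ {p = tabulate (does ∘ P?)} (trans (∣tabulate∣ (does ∘ P?)) eq)) ⟩
  lookup (Vec.replicate _ inside) i  ≡⟨ lookup-replicate i inside ⟩
  true                               ∎)

-- Splitting a finite type into two blocks.

extendˡ : ∀ {m r k} → Fin m ↔ (Fin r ⊎ Fin k) → Fin (suc m) ↔ (Fin (suc r) ⊎ Fin k)
extendˡ {m} {r} {k} e = mk↔ₛ′ to′ from′ to∘from from∘to
  where
  open Inverse e
  to′ : Fin (suc m) → Fin (suc r) ⊎ Fin k
  to′ zero    = inj₁ zero
  to′ (suc i) = map₁ suc (to i)
  from′ : Fin (suc r) ⊎ Fin k → Fin (suc m)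
  from′ (inj₁ zero)    = zero
  from′ (inj₁ (suc u)) = suc (from (inj₁ u))
  from′ (inj₂ z)       = suc (from (inj₂ z))
  from′-map : ∀ x → from′ (map₁ suc x) ≡ suc (from x)
  from′-map (inj₁ _) = refl
  from′-map (inj₂ _) = refl
  to∘from : ∀ x → to′ (from′ x) ≡ x
  to∘from (inj₁ zero)    = refl
  to∘from (inj₁ (suc u)) = cong (map₁ suc) (strictlyInverseˡ (inj₁ u))
  to∘from (inj₂ z)       = cong (map₁ suc) (strictlyInverseˡ (inj₂ z))
  from∘to : ∀ i → from′ (to′ i) ≡ i
  from∘to zero    = refl
  from∘to (suc i) = trans (from′-map (to i)) (cong suc (strictlyInverseʳ i))

⊎-swap : ∀ {A B : Set} → (A ⊎ B) ↔ (B ⊎ A)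
⊎-swap = mk↔ₛ′ swap swap swap-involutive swap-involutive

extendʳ : ∀ {m r k} → Fin m ↔ (Fin r ⊎ Fin k) → Fin (suc m) ↔ (Fin r ⊎ Fin (suc k))
extendʳ e = ⊎-swap ↔-∘ extendˡ (⊎-swap ↔-∘ e)

-- Scans the indices upwards, sending the first `k` that satisfy `P` to the right and all others to
-- the left. Asking only for at least `k` lets further indices with `P` stay on the left, as for
-- `n = 1`, where a third vertex has codegree 1.
splitOff : ∀ {m} k {P : Fin m → Set} (P? : Decidable P) → k ≤ sum (λ i → ⟦ P? i ⟧) →
           ∃₂ λ r (e : Fin m ↔ (Fin r ⊎ Fin k)) → ∀ z → P (Inverse.from e (inj₂ z))
splitOff {zero}  zero    P? _ = 0 , Fin.+↔⊎ , λ ()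
splitOff {suc m} zero    P? _ with r , e , _ ← splitOff zero (P? ∘ suc) z≤n = suc r , extendˡ e , λ ()
splitOff {suc m} (suc k) P? k≤ with P? zero
... | no  _ with r , e , Pe ← splitOff (suc k) (P? ∘ suc) k≤ = suc r , extendˡ e , Pe
... | yes p with r , e , Pe ← splitOff k (P? ∘ suc) (s≤s⁻¹ k≤) =
  r , extendʳ e , λ { zero → p ; (suc z) → Pe z }

-- Codegrees and relabelling of vertices.

codegree : ∀ {m} → Graph (Fin m) → Fin m → ℕ
codegree G i = sum λ v → ⟦ ¬? (i ~? v) ⟧
  where open Graph G

infix 4 _≐_
_≐_ : ∀ {V} → Graph V → Graph V → Set
G ≐ H = ∀ u v → u G.~ v ⇔ u H.~ v
  where
  module G = Graph G
  module H = Graph H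

-- Carrying `G` along the bijection puts it on the target vertex type, so that an isomorphism
-- becomes a pointwise comparison `_≐_` of two graphs on one type.
relabel : ∀ {V W : Set} → V ↔ W → Graph V → Graph W
relabel e G = record
  { _~_   = λ x y → from x G.~ from y
  ; ~-sym = G.~-sym
  ; ~-irr = G.~-irr
  ; _~?_  = λ x y → from x G.~? from y
  }
  where
  module G = Graph G
  open Inverse e

module _ {V W : Set} {G : Graph V} {H : Graph W} where

  ≅⇒relabel≐ : (iso : G ≅ H) → relabel (_≅_.bijection iso) G ≐ H
  ≅⇒relabel≐ iso x y = subst₂ (λ x′ y′ → from x G.~ from y ⇔ x′ H.~ y′)
                         (strictlyInverseˡ x) (strictlyInverseˡ y) (adjacency (from x) (from y))
    where
    module G = Graph G
    module H = Graph H
    open _≅_ iso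
    open Inverse bijection

  relabel≐⇒≅ : (e : V ↔ W) → relabel e G ≐ H → G ≅ H
  relabel≐⇒≅ e eq = record
    { bijection = e
    ; adjacency = λ u v → subst₂ (λ u′ v′ → u′ G.~ v′ ⇔ to u H.~ to v)
                            (strictlyInverseʳ u) (strictlyInverseʳ v) (eq (to u) (to v))
    }
    where
    module G = Graph G
    module H = Graph H
    open Inverse e

-- Two sums, in the shape produced by `sum-⊎`, so that non-neighbours among pages and among centres
-- can be counted separately.
codegree⊎ : ∀ {k l} → Graph (Fin k ⊎ Fin l) → Fin k ⊎ Fin l → ℕ
codegree⊎ H x = sum (λ u → ⟦ ¬? (x ~? inj₁ u) ⟧) + sum (λ z → ⟦ ¬? (x ~? inj₂ z) ⟧)
  where open Graph H

codegree-relabel : ∀ {m k l} (G : Graph (Fin m)) (e : Fin m ↔ (Fin k ⊎ Fin l)) x →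
                   codegree G (Inverse.from e x) ≡ codegree⊎ (relabel e G) x
codegree-relabel G e x = sum-⊎ e (λ v → ⟦ ¬? (Inverse.from e x ~? v) ⟧)
  where open Graph G

codegree⊎-cong : ∀ {k l} (H K : Graph (Fin k ⊎ Fin l)) → H ≐ K → ∀ x → codegree⊎ H x ≡ codegree⊎ K x
codegree⊎-cong H K H≐K x = cong₂ _+_ (sum-cong-≗ (nonadjacent ∘ inj₁)) (sum-cong-≗ (nonadjacent ∘ inj₂))
  where
  nonadjacent : ∀ y → ⟦ ¬? (Graph._~?_ H x y) ⟧ ≡ ⟦ ¬? (Graph._~?_ K x y) ⟧
  nonadjacent y = cong (𝟙 ∘ not) (does-⇔ (H≐K x y) (Graph._~?_ H x y) (Graph._~?_ K x y))

-- Book graphs are determined by their codegrees.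

bookCodegree : ∀ {n} → Fin n ⊎ Fin 2 → ℕ
bookCodegree {n} (inj₁ _) = n
bookCodegree     (inj₂ _) = 1

codegree-B : ∀ n x → codegree⊎ (B n) x ≡ bookCodegree x
codegree-B n (inj₁ u)  = trans (ℕ.+-identityʳ _) (trans (sum-const {n} (λ _ → refl)) (ℕ.*-identityʳ n))
codegree-B n (inj₂ 0F) = cong (_+ 1) (trans (sum-const {n} (λ _ → refl)) (ℕ.*-zeroʳ n))
codegree-B n (inj₂ 1F) = cong (_+ 1) (trans (sum-const {n} (λ _ → refl)) (ℕ.*-zeroʳ n))

module _ {n} (H : Graph (Fin n ⊎ Fin 2)) (codegree-H : ∀ x → codegree⊎ H x ≡ bookCodegree x) where
  open Graph H
  private
    nonadjacent : Fin n ⊎ Fin 2 → Fin n ⊎ Fin 2 → ℕ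
    nonadjacent x y = ⟦ ¬? (x ~? y) ⟧

    nonadjacent-refl : ∀ x → nonadjacent x x ≡ 1
    nonadjacent-refl x = ⟦⟧-true (¬? (x ~? x)) ~-irr

    ~⇒nonadjacent≡0 : ∀ {x y} → x ~ y → nonadjacent x y ≡ 0
    ~⇒nonadjacent≡0 {x} {y} x~y with x ~? y
    ... | yes _  = refl
    ... | no x≁y = contradiction x~y x≁y

    nonadjacent-pages : Fin 2 → ℕ
    nonadjacent-pages z = sum (λ u → nonadjacent (inj₂ z) (inj₁ u))

    -- The centre itself accounts for its whole codegree 1, so nothing is left among the pages or at
    -- the other centre, which is `opposite z`.
    non-neighbours-of-centre : ∀ z → nonadjacent-pages z + nonadjacent (inj₂ z) (inj₂ (opposite z)) ≡ 0
    non-neighbours-of-centre 0F =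
      cancel (nonadjacent-pages 0F) _ _ (codegree-H (inj₂ 0F)) (nonadjacent-refl (inj₂ 0F))
      where
      -- A sum over `Fin 2` unfolds to `b + (c + 0)`; the centre's own summand is `b` for `0F` and
      -- `c` for `1F`.
      cancel : ∀ a b c → a + (b + (c + 0)) ≡ 1 → b ≡ 1 → a + c ≡ 0
      cancel a _ c eq refl = ℕ.suc-injective (begin
        suc (a + c)        ≡⟨ ℕ.+-suc a c ⟨
        a + suc c          ≡⟨ cong (λ t → a + suc t) (ℕ.+-identityʳ c) ⟨
        a + (1 + (c + 0))  ≡⟨ eq ⟩
        1                  ∎)
    non-neighbours-of-centre 1F =
      cancel (nonadjacent-pages 1F) _ _ (codegree-H (inj₂ 1F)) (nonadjacent-refl (inj₂ 1F))
      where
      cancel : ∀ a b c → a + (b + (c + 0)) ≡ 1 → c ≡ 1 → a + b ≡ 0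
      cancel a b _ eq refl = ℕ.+-cancelʳ-≡ 1 (a + b) 0 (trans (ℕ.+-assoc a b 1) eq)

    centre~page : ∀ z u → inj₂ z ~ inj₁ u
    centre~page z u = ⟦¬⟧≡0⇒ (inj₂ z ~? inj₁ u) (sum≡0⇒≡0 _ (ℕ.m+n≡0⇒m≡0 (nonadjacent-pages z) (non-neighbours-of-centre z)) u)

    centre~opposite : ∀ z → inj₂ z ~ inj₂ (opposite z)
    centre~opposite z = ⟦¬⟧≡0⇒ (inj₂ z ~? inj₂ (opposite z)) (ℕ.m+n≡0⇒n≡0 (nonadjacent-pages z) (non-neighbours-of-centre z))

    centre~centre : ∀ {y z} → y ≢ z → inj₂ y ~ inj₂ z
    centre~centre {0F} {0F} y≢z = contradiction refl y≢z
    centre~centre {0F} {1F} _   = centre~opposite 0F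
    centre~centre {1F} {0F} _   = centre~opposite 1F
    centre~centre {1F} {1F} y≢z = contradiction refl y≢z

    page≁page : ∀ u v → ¬ (inj₁ u ~ inj₁ v)
    page≁page u = sum≡n⇒all (λ v → ¬? (inj₁ u ~? inj₁ v)) (begin
      pages            ≡⟨ ℕ.+-identityʳ pages ⟨
      -- Both centres are adjacent to `u` and contribute 0 each, so all `n` non-neighbours lie among
      -- the `n` pages.
      pages + 2 * 0    ≡⟨ cong (pages +_) (sum-const λ z → ~⇒nonadjacent≡0 (~-sym (centre~page z u))) ⟨
      codegree⊎ H (inj₁ u)  ≡⟨ codegree-H (inj₁ u) ⟩
      n                ∎)
      where pages = sum (λ v → nonadjacent (inj₁ u) (inj₁ v))

  codegree-characterises-B : H ≐ B n
  codegree-characterises-B (inj₁ u) (inj₁ v) = mk⇔ (page≁page u v) λ ()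
  codegree-characterises-B (inj₁ u) (inj₂ z) = mk⇔ (λ _ → tt) (λ _ → ~-sym (centre~page z u))
  codegree-characterises-B (inj₂ z) (inj₁ u) = mk⇔ (λ _ → tt) (λ _ → centre~page z u)
  codegree-characterises-B (inj₂ y) (inj₂ z) = mk⇔ (λ { y~z refl → ~-irr y~z }) centre~centre

-- Sums over all subsets.

sum-filter : ∀ {A : Set} {P : A → Set} (P? : Decidable P) (φ : A → ℕ) xs →
             List.sum (map φ (filter P? xs)) ≡ List.sum (map (λ x → if does (P? x) then φ x else 0) xs)
sum-filter P? φ []       = refl
sum-filter P? φ (x ∷ xs) with does (P? x)
... | true  = cong (φ x +_) (sum-filter P? φ xs)
... | false = sum-filter P? φ xs

sum-map≡0 : ∀ {A : Set} {φ : A → ℕ} → (∀ x → φ x ≡ 0) → ∀ xs → List.sum (map φ xs) ≡ 0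
sum-map≡0 φ≡0 []       = refl
sum-map≡0 φ≡0 (x ∷ xs) = cong₂ _+_ (φ≡0 x) (sum-map≡0 φ≡0 xs)

sum-subsets-suc : ∀ {m} (φ : Subset (suc m) → ℕ) → List.sum (map φ (subsets (suc m))) ≡
  List.sum (map (φ ∘ (outside Vec.∷_)) (subsets m)) + List.sum (map (φ ∘ (inside Vec.∷_)) (subsets m))
sum-subsets-suc {m} φ = begin
  List.sum (map φ (map (outside Vec.∷_) Ss ++ map (inside Vec.∷_) Ss))
    ≡⟨ cong List.sum (map-++ φ (map (outside Vec.∷_) Ss) _) ⟩
  List.sum (map φ (map (outside Vec.∷_) Ss) ++ map φ (map (inside Vec.∷_) Ss))
    ≡⟨ sum-++ (map φ (map (outside Vec.∷_) Ss)) _ ⟩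
  List.sum (map φ (map (outside Vec.∷_) Ss)) + List.sum (map φ (map (inside Vec.∷_) Ss))
    ≡⟨ cong₂ (λ xs ys → List.sum xs + List.sum ys) (map-∘ Ss) (map-∘ Ss) ⟨
  List.sum (map (φ ∘ (outside Vec.∷_)) Ss) + List.sum (map (φ ∘ (inside Vec.∷_)) Ss) ∎
  where Ss = subsets m

-- Subsets containing `zero` have positive size, so each step of the recursion discards the second
-- half of `subsets`.
sum-subsets-∅ : ∀ {m} (φ : Subset m → ℕ) → (∀ S → ∣ S ∣ ≢ 0 → φ S ≡ 0) →
                List.sum (map φ (subsets m)) ≡ φ ∅
sum-subsets-∅ {zero}  φ φ≡0 = ℕ.+-identityʳ _
sum-subsets-∅ {suc m} φ φ≡0 = begin
  List.sum (map φ (subsets (suc m)))  ≡⟨ sum-subsets-suc φ ⟩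
  _                                   ≡⟨ cong₂ _+_ (sum-subsets-∅ (φ ∘ (outside Vec.∷_)) (λ S → φ≡0 (outside Vec.∷ S)))
                                                   (sum-map≡0 (λ S → φ≡0 (inside Vec.∷ S) λ ()) (subsets m)) ⟩
  φ ∅ + 0                             ≡⟨ ℕ.+-identityʳ _ ⟩
  φ ∅                                 ∎

-- A singleton either avoids `zero`, which is the recursive case, or is `inside` followed by the
-- empty set, which `sum-subsets-∅` picks out.
sum-subsets-⁅⁆ : ∀ {m} (φ : Subset m → ℕ) → (∀ S → ∣ S ∣ ≢ 1 → φ S ≡ 0) →
                 List.sum (map φ (subsets m)) ≡ sum (λ i → φ ⁅ i ⁆)
sum-subsets-⁅⁆ {zero}  φ φ≡0 = trans (ℕ.+-identityʳ _) (φ≡0 Vec.[] λ ())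
sum-subsets-⁅⁆ {suc m} φ φ≡0 = begin
  List.sum (map φ (subsets (suc m)))  ≡⟨ sum-subsets-suc φ ⟩
  _                                   ≡⟨ cong₂ _+_ (sum-subsets-⁅⁆ (φ ∘ (outside Vec.∷_)) (λ S → φ≡0 (outside Vec.∷ S)))
                                                   (sum-subsets-∅ (φ ∘ (inside Vec.∷_)) λ S ∣S∣≢0 → φ≡0 (inside Vec.∷ S) (∣S∣≢0 ∘ ℕ.suc-injective)) ⟩
  -- `subsets` lists the subsets without `zero` first, whereas `sum` starts at `zero`.
  sum (λ i → φ ⁅ suc i ⁆) + φ ⁅ zero ⁆  ≡⟨ ℕ.+-comm _ (φ ⁅ zero ⁆) ⟩
  sum (λ i → φ ⁅ i ⁆)                 ∎

-- The summand of a single vertex.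

minimum-constant : ∀ {v ks} → ∃ (_∈ₗ ks) → All (_≡ v) ks → minimum ks ≡ v
-- The membership witness excludes `[]`, where `minimum` takes its default value 0.
minimum-constant {ks = k ∷ ks} _ (refl ∷ ks≡k) =
  ℕ.≤-antisym (min≤⊤ k ks) (v≤min⁺ ℕ.≤-refl (All.map (ℕ.≤-reflexive ∘ sym) ks≡k))

-- Without loops, `i` has no neighbour in `⁅ i ⁆` and all its neighbours in the complement. The
-- minimum is thus `m` minus the degree of `i`, the size of the complement of the neighbourhood.
fy-⁅⁆ : ∀ {m} (G : Graph (Fin m)) i → fy G ⁅ i ⁆ ≡ codegree G i
fy-⁅⁆ {m} G i = trans (minimum-constant (_ , ∈-map⁺ value i∈) values≡) value-i
  where
  open Graph G

  value : Fin m → ℕ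
  value u = (δ G ⁅ i ⁆ u + m) ∸ δ G (∁ ⁅ i ⁆) u

  i∈ : i ∈ₗ elements ⁅ i ⁆
  i∈ = ∈-filter⁺ (_∈? ⁅ i ⁆) (∈-allFin i) (x∈⁅x⁆ i)

  values≡ : All (_≡ value i) (map value (elements ⁅ i ⁆))
  -- `elements ⁅ i ⁆` is never computed: membership already forces each entry to be `i`.
  values≡ = All.map⁺ (All.map (cong value ∘ x∈⁅y⁆⇒x≡y i) (All.all-filter (_∈? ⁅ i ⁆) (allFin m)))

  N = neighbours G i

  i∉N : ¬ (i ∈ N)
  i∉N i∈N = ~-irr (does≡true⇒ (i ~? i) (trans (sym (lookup∘tabulate (λ v → does (i ~? v)) i)) ([]=⇒lookup i∈N)))

  ⁅i⁆∩N≡∅ : ⁅ i ⁆ ∩ N ≡ ∅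
  ⁅i⁆∩N≡∅ = Empty-unique λ (j , j∈) → let j∈⁅i⁆ , j∈N = x∈p∩q⁻ ⁅ i ⁆ N j∈ in
    i∉N (subst (_∈ N) (x∈⁅y⁆⇒x≡y i j∈⁅i⁆) j∈N)

  ∁⁅i⁆∩N≡N : ∁ ⁅ i ⁆ ∩ N ≡ N
  ∁⁅i⁆∩N≡N = ⊆-antisym (p∩q⊆q (∁ ⁅ i ⁆) N) λ j∈N →
    x∈p∩q⁺ (x∉p⇒x∈∁p (λ j∈⁅i⁆ → i∉N (subst (_∈ N) (x∈⁅y⁆⇒x≡y i j∈⁅i⁆) j∈N)) , j∈N)

  value-i : value i ≡ codegree G i
  value-i = begin
    (∣ ⁅ i ⁆ ∩ N ∣ + m) ∸ ∣ ∁ ⁅ i ⁆ ∩ N ∣  ≡⟨ cong₂ (λ p q → (∣ p ∣ + m) ∸ ∣ q ∣) ⁅i⁆∩N≡∅ ∁⁅i⁆∩N≡N ⟩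
    (∣ ∅ {m} ∣ + m) ∸ ∣ N ∣                ≡⟨ cong (λ k → (k + m) ∸ ∣ N ∣) (∣⊥∣≡0 m) ⟩
    m ∸ ∣ N ∣                              ≡⟨ ∣∁p∣≡n∸∣p∣ N ⟨
    ∣ ∁ N ∣                                ≡⟨ cong ∣_∣ (tabulate-∘ not (λ v → does (i ~? v))) ⟨
    ∣ tabulate (λ v → not (does (i ~? v))) ∣ ≡⟨ ∣tabulate∣ (λ v → not (does (i ~? v))) ⟩
    codegree G i                           ∎

⁅⁆-connected : ∀ {m} (G : Graph (Fin m)) i → Connected (G ⟨ ⁅ i ⁆ ⟩)
⁅⁆-connected G i (u , u∈) (v , v∈)
  with refl ← x∈⁅y⁆⇒x≡y i u∈
  with refl ← x∈⁅y⁆⇒x≡y i v∈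
  -- Vertices of the induced graph carry membership proofs, which must also agree before the empty
  -- walk fits.
  with refl ← []=-irrelevant u∈ v∈ = ε

-- Coefficients of polynomials.

coeff-⊕ : ∀ j p q → Y.coeff j (p ⊕ q) ≡ Y.coeff j p + Y.coeff j q
coeff-⊕ j       []      q       = refl
coeff-⊕ j       (a ∷ p) []      = sym (ℕ.+-identityʳ _)
coeff-⊕ zero    (a ∷ p) (b ∷ q) = refl
coeff-⊕ (suc j) (a ∷ p) (b ∷ q) = coeff-⊕ j p q

⊕-identityʳ : ∀ p → p ⊕ [] ≡ p
⊕-identityʳ []      = refl
⊕-identityʳ (_ ∷ _) = refl

[x^]-+ᴾ : ∀ k p q → [x^ k ] (p X.+ᴾ q) ≡ ([x^ k ] p) ⊕ ([x^ k ] q)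
[x^]-+ᴾ k       []      q       = refl
[x^]-+ᴾ k       (a ∷ p) []      = sym (⊕-identityʳ _)
[x^]-+ᴾ zero    (a ∷ p) (b ∷ q) = refl
[x^]-+ᴾ (suc k) (a ∷ p) (b ∷ q) = [x^]-+ᴾ k p q

coeff-[x^]-sum : ∀ j k ps → Y.coeff j ([x^ k ] foldr X._+ᴾ_ [] ps) ≡ List.sum (map (λ p → Y.coeff j ([x^ k ] p)) ps)
coeff-[x^]-sum j k []       = refl
coeff-[x^]-sum j k (p ∷ ps) = begin
  Y.coeff j ([x^ k ] (p X.+ᴾ foldr X._+ᴾ_ [] ps))                      ≡⟨ cong (Y.coeff j) ([x^]-+ᴾ k p _) ⟩
  Y.coeff j (([x^ k ] p) ⊕ ([x^ k ] foldr X._+ᴾ_ [] ps))               ≡⟨ coeff-⊕ j ([x^ k ] p) _ ⟩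
  Y.coeff j ([x^ k ] p) + Y.coeff j ([x^ k ] foldr X._+ᴾ_ [] ps)       ≡⟨ cong (Y.coeff j ([x^ k ] p) +_) (coeff-[x^]-sum j k ps) ⟩
  _ ∎

coeff-·y^ : ∀ a t j → Y.coeff j (a ·y^ t) ≡ a * ⟦ t ≟ j ⟧
coeff-·y^ a zero    zero    = sym (ℕ.*-identityʳ a)
coeff-·y^ a zero    (suc j) = sym (ℕ.*-zeroʳ a)
coeff-·y^ a (suc t) zero    = sym (ℕ.*-zeroʳ a)
coeff-·y^ a (suc t) (suc j) = coeff-·y^ a t j

[x^1]-x^≢1 : ∀ s t → s ≢ 1 → [x^ 1 ] (x^ s y^ t) ≡ []
[x^1]-x^≢1 zero          t s≢1 = refl
[x^1]-x^≢1 (suc zero)    t s≢1 = contradiction refl s≢1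
[x^1]-x^≢1 (suc (suc zero)) t s≢1 = refl
[x^1]-x^≢1 (suc (suc (suc s))) t s≢1 = refl

-- The coefficient of x counts vertices by codegree.

module _ {m} (G : Graph (Fin m)) where

  -- The filter inside `da` is local to its definition and cannot be named. An arbitrary decidable
  -- `P` that holds on singletons stands for it; `coeff-da` recovers it by unification.
  coeff-singletons : ∀ {P : Subset m → Set} (P? : Decidable P) → (∀ i → P ⁅ i ⁆) → ∀ j →
    Y.coeff j ([x^ 1 ] foldr X._+ᴾ_ [] (map (λ S → x^ ∣ S ∣ y^ fy G S) (filter P? (subsets m))))
      ≡ sum (λ i → ⟦ codegree G i ≟ j ⟧)
  coeff-singletons P? P⁅⁆ j = begin
    Y.coeff j ([x^ 1 ] foldr X._+ᴾ_ [] (map term Ss))  ≡⟨ coeff-[x^]-sum j 1 (map term Ss) ⟩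
    List.sum (map coeff (map term Ss))                 ≡⟨ cong List.sum (map-∘ Ss) ⟨
    -- Zero summands replace the filter, so that the sum runs over all of `subsets m` and follows
    -- its recursion.
    List.sum (map (coeff ∘ term) Ss)                   ≡⟨ sum-filter P? (coeff ∘ term) (subsets m) ⟩
    List.sum (map φ (subsets m))                       ≡⟨ sum-subsets-⁅⁆ φ φ≡0 ⟩
    sum (λ i → φ ⁅ i ⁆)                                ≡⟨ sum-cong-≗ φ-⁅⁆ ⟩
    sum (λ i → ⟦ codegree G i ≟ j ⟧)                   ∎
    where
    Ss = filter P? (subsets m)

    term : Subset m → ℕ[x,y]
    term S = x^ ∣ S ∣ y^ fy G S

    coeff : ℕ[x,y] → ℕ
    coeff p = Y.coeff j ([x^ 1 ] p)

    φ : Subset m → ℕ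
    φ S = if does (P? S) then coeff (term S) else 0

    φ≡0 : ∀ S → ∣ S ∣ ≢ 1 → φ S ≡ 0
    φ≡0 S ∣S∣≢1 with does (P? S)
    ... | true  = cong (Y.coeff j) ([x^1]-x^≢1 ∣ S ∣ (fy G S) ∣S∣≢1)
    ... | false = refl

    φ-⁅⁆ : ∀ i → φ ⁅ i ⁆ ≡ ⟦ codegree G i ≟ j ⟧
    φ-⁅⁆ i = begin
      φ ⁅ i ⁆                              ≡⟨ cong (λ b → if b then coeff (term ⁅ i ⁆) else 0) (dec-true (P? ⁅ i ⁆) (P⁅⁆ i)) ⟩
      coeff (x^ ∣ ⁅ i ⁆ ∣ y^ fy G ⁅ i ⁆)   ≡⟨ cong₂ (λ s t → coeff (x^ s y^ t)) (∣⁅x⁆∣≡1 i) (fy-⁅⁆ G i) ⟩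
      Y.coeff j (1 ·y^ codegree G i)       ≡⟨ coeff-·y^ 1 (codegree G i) j ⟩
      1 * ⟦ codegree G i ≟ j ⟧             ≡⟨ ℕ.*-identityˡ _ ⟩
      ⟦ codegree G i ≟ j ⟧                 ∎

  coeff-da : ∀ j → Y.coeff j ([x^ 1 ] da G) ≡ sum (λ i → ⟦ codegree G i ≟ j ⟧)
  coeff-da = coeff-singletons _ λ i → (i , x∈⁅x⁆ i) , ⁅⁆-connected G i

-- The two implications.

bookPoly : ℕ → ℕ[y]
bookPoly n = 2 ·y^ 1 ⊕ n ·y^ n

coeff-bookPoly : ∀ n j → Y.coeff j (bookPoly n) ≡ n * ⟦ n ≟ j ⟧ + 2 * ⟦ 1 ≟ j ⟧
coeff-bookPoly n j = begin
  Y.coeff j (bookPoly n)                          ≡⟨ coeff-⊕ j (2 ·y^ 1) (n ·y^ n) ⟩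
  Y.coeff j (2 ·y^ 1) + Y.coeff j (n ·y^ n)       ≡⟨ cong₂ _+_ (coeff-·y^ 2 1 j) (coeff-·y^ n n j) ⟩
  -- The page term goes first, as in `Fin n ⊎ Fin 2`.
  2 * ⟦ 1 ≟ j ⟧ + n * ⟦ n ≟ j ⟧                   ≡⟨ ℕ.+-comm (2 * ⟦ 1 ≟ j ⟧) _ ⟩
  n * ⟦ n ≟ j ⟧ + 2 * ⟦ 1 ≟ j ⟧                   ∎

-- Codegrees survive relabelling, so the count splits into `n` pages of codegree `n` and two centres
-- of codegree 1.
≅B⇒≈ : ∀ n {m} (G : Graph (Fin m)) → G ≅ B n → [x^ 1 ] da G ≈ bookPoly n
≅B⇒≈ n {m} G iso j = begin
  Y.coeff j ([x^ 1 ] da G)       ≡⟨ coeff-da G j ⟩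
  sum count                      ≡⟨ sum-⊎ bijection count ⟩
  sum (count ∘ from ∘ inj₁) + sum (count ∘ from ∘ inj₂)
    ≡⟨ cong₂ _+_ (sum-const (count-from ∘ inj₁)) (sum-const (count-from ∘ inj₂)) ⟩
  n * ⟦ n ≟ j ⟧ + 2 * ⟦ 1 ≟ j ⟧  ≡⟨ coeff-bookPoly n j ⟨
  Y.coeff j (bookPoly n)         ∎
  where
  open _≅_ iso
  open Inverse bijection

  count : Fin m → ℕ
  count i = ⟦ codegree G i ≟ j ⟧

  count-from : ∀ x → count (from x) ≡ ⟦ bookCodegree x ≟ j ⟧
  count-from x = cong (λ c → ⟦ c ≟ j ⟧) (begin
    codegree G (from x)                ≡⟨ codegree-relabel G bijection x ⟩
    codegree⊎ (relabel bijection G) x  ≡⟨ codegree⊎-cong (relabel bijection G) (B n) (≅⇒relabel≐ iso) x ⟩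
    codegree⊎ (B n) x                  ≡⟨ codegree-B n x ⟩
    bookCodegree x                     ∎)

≈⇒≅B : ∀ n {m} (G : Graph (Fin m)) → [x^ 1 ] da G ≈ bookPoly n → G ≅ B n
≈⇒≅B n {m} G eq = build (splitOff 2 (λ i → codegree G i ≟ 1) two≤)
  where
  counts : ∀ j → sum (λ i → ⟦ codegree G i ≟ j ⟧) ≡ n * ⟦ n ≟ j ⟧ + 2 * ⟦ 1 ≟ j ⟧
  counts j = trans (sym (coeff-da G j)) (trans (eq j) (coeff-bookPoly n j))

  -- For `n = 1` the coefficient of `y` is 3, so 2 is only a lower bound.
  two≤ : 2 ≤ sum (λ i → ⟦ codegree G i ≟ 1 ⟧)
  two≤ = ℕ.≤-trans (ℕ.m≤n+m 2 (n * ⟦ n ≟ 1 ⟧)) (ℕ.≤-reflexive (sym (counts 1)))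

  build : (∃₂ λ r (e : Fin m ↔ (Fin r ⊎ Fin 2)) → ∀ z → codegree G (Inverse.from e (inj₂ z)) ≡ 1) → G ≅ B n
  build (r , e , codegree-centre) =
    -- The number `r` of remaining vertices is identified with `n` only through their codegrees, so
    -- the isomorphism is built onto `B r` and then transported.
    subst (λ k → G ≅ B k) r≡n (relabel≐⇒≅ e (codegree-characterises-B (relabel e G) codegree≡))
    where
    open Inverse e

    -- The two split-off vertices contribute exactly the term of `2y`; it cancels for every `j`,
    -- even where it overlaps the other term.
    counts-pages : ∀ j → sum (λ u → ⟦ codegree G (from (inj₁ u)) ≟ j ⟧) ≡ n * ⟦ n ≟ j ⟧
    counts-pages j = ℕ.+-cancelʳ-≡ (2 * ⟦ 1 ≟ j ⟧) _ _ (begin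
      sum (λ u → ⟦ codegree G (from (inj₁ u)) ≟ j ⟧) + 2 * ⟦ 1 ≟ j ⟧
        ≡⟨ cong (sum (λ u → ⟦ codegree G (from (inj₁ u)) ≟ j ⟧) +_) (sum-const λ z → cong (λ c → ⟦ c ≟ j ⟧) (codegree-centre z)) ⟨
      _                                     ≡⟨ sum-⊎ e (λ i → ⟦ codegree G i ≟ j ⟧) ⟨
      sum (λ i → ⟦ codegree G i ≟ j ⟧)      ≡⟨ counts j ⟩
      n * ⟦ n ≟ j ⟧ + 2 * ⟦ 1 ≟ j ⟧         ∎)

    -- If the codegree `c` of page `u` differed from `n`, then `counts-pages c` would leave no page
    -- of codegree `c`, yet `u` is one.
    codegree-page : ∀ u → codegree G (from (inj₁ u)) ≡ n
    codegree-page u with n ≟ codegree G (from (inj₁ u)) in n≟c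
    ... | yes n≡c = sym n≡c
    ... | no  n≢c = contradiction (trans (sym (⟦⟧-true (c ≟ c) refl)) (sum≡0⇒≡0 _ none u)) λ ()
      where
      c = codegree G (from (inj₁ u))
      none : sum (λ v → ⟦ codegree G (from (inj₁ v)) ≟ c ⟧) ≡ 0
      none = trans (counts-pages c) (trans (cong (λ d → n * ⟦ d ⟧) n≟c) (ℕ.*-zeroʳ n))

    -- At `j = n` every page is counted, which gives `r` on one side and `n` on the other.
    r≡n : r ≡ n
    r≡n = begin
      r              ≡⟨ ℕ.*-identityʳ r ⟨
      r * 1          ≡⟨ sum-const (λ u → ⟦⟧-true (codegree G (from (inj₁ u)) ≟ n) (codegree-page u)) ⟨
      _              ≡⟨ counts-pages n ⟩
      n * ⟦ n ≟ n ⟧  ≡⟨ cong (n *_) (⟦⟧-true (n ≟ n) refl) ⟩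
      n * 1          ≡⟨ ℕ.*-identityʳ n ⟩
      n              ∎

    codegree≡ : ∀ x → codegree⊎ (relabel e G) x ≡ bookCodegree x
    -- Here `bookCodegree` lives on `Fin r ⊎ Fin 2`, so its value at a page is `r`.
    codegree≡ (inj₁ u) = trans (sym (codegree-relabel G e (inj₁ u))) (trans (codegree-page u) (sym r≡n))
    codegree≡ (inj₂ z) = trans (sym (codegree-relabel G e (inj₂ z))) (codegree-centre z)

proposition38 : ∀ (n : ℕ) .{{_ : NonZero n}} {m : ℕ} .{{_ : NonZero m}} (G : Graph (Fin m)) →
    (G ≅ B n) ⇔ ([x^ 1 ] (da G) ≈ 2 ·y^ 1 ⊕ n ·y^ n)
proposition38 n G = mk⇔ (≅B⇒≈ n G) (≈⇒≅B n G)
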